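{- For every integer $n \geq 2$, \[|\mathrm{ParseWords}(\mathrm{LeftCrookedTree}(n), \mathrm{RightCrookedTree}(n))| = 2^{\lfloor n/2 \rfloor - 1}.\]
   Context: A binary tree is a rooted ordered tree in which each vertex has either $0$ or $2$ children; its leaves are ordered left to right. Let $G$ be the context-free grammar with start symbols $0,1,2$ and rules $0\to 12$, $0\to 21$, $1\to 02$, $1\to 20$, $2\to 01$, $2\to 10$. An $n$-leaf binary tree $T$ parses a word $w$ of length $n$ on $\{0,1,2\}$ if there is a labeling of the vertices of $T$ by $0,1,2$ such that the leaves, from left to right, are labeled with the letters of $w$, and at every internal vertex the label of the vertex together with the labels of its left and right children form a rule of $G$ (i.e. the three labels are pairwise distinct). If $T$ parses $w$, it also parses every word obtained from $w$ by permuting the alphabet $\{0,1,2\}$. For $n$-leaf binary trees $T_1,T_2$, $\mathrm{ParseWords}(T_1,T_2)$ denotes the set of equivalence classes (under permutations of the alphabet $\{0,1,2\}$) of words parsed by both $T_1$ and $T_2$. The level of a vertex is its distance from the root. A path tree is a binary tree with at most two vertices on each level. For $n\ge 2$, $n$-leaf path trees correspond bijectively to words $x_1\cdots x_{n-2}$ on $\{l,r\}$: $x_j=l$ (resp. $x_j=r$) means that, of the two vertices on level $j$, the left (resp. right) one has children. $\mathrm{LeftCrookedTree}(n)$ is the $n$-leaf path tree corresponding to the alternating word $lrlr\cdots$ of length $n-2$ (starting with $l$), and $\mathrm{RightCrookedTree}(n)$ is the one corresponding to the alternating word $rlrl\cdots$ of length $n-2$ (starting with $r$). -}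

module Defs where

open import Data.Fin using (Fin)
open import Data.Fin.Patterns using (0F; 1F; 2F)
open import Data.Fin.Permutation as Perm using (Permutation′; _⟨$⟩ʳ_; _∘ₚ_; flip)
open import Data.List using (List; []; _∷_; [_]; _++_; map; length)
open import Data.List.Properties using (length-++; map-id; map-∘; map-cong)
open import Data.Nat using (ℕ; zero; suc; _+_; _∸_; _≤_; s≤s)
open import Data.Nat.Properties using (+-comm)
open import Data.Product using (∃-syntax; Σ-syntax; _×_; _,_; proj₁)
open import Data.Unit using (⊤)
open import Function.Bundles using (Bijection)
open import Level using (0ℓ)
open import Relation.Binary.Bundles using (Setoid)
import Relation.Binary.Construct.On as On
open import Relation.Binary.PropositionalEquality
  using (_≡_; refl; sym; trans; cong; cong₂; setoid)

Letter : Set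
Letter = Fin 3

Word : Set
Word = List Letter

data Rule : Letter → Letter → Letter → Set where
  0→12 : Rule 0F 1F 2F
  0→21 : Rule 0F 2F 1F
  1→02 : Rule 1F 0F 2F
  1→20 : Rule 1F 2F 0F
  2→01 : Rule 2F 0F 1F
  2→10 : Rule 2F 1F 0F

data BinaryTree : Set where
  leaf : BinaryTree
  node : BinaryTree → BinaryTree → BinaryTree

leafCount : BinaryTree → ℕ
leafCount leaf       = 1
leafCount (node s t) = leafCount s + leafCount t

-- An assignment of a letter to every vertex, internal vertices included.
data Labeling : BinaryTree → Set where
  leaf : Letter → Labeling leaf
  node : ∀ {s t} → Letter → Labeling s → Labeling t → Labeling (node s t)

rootLabel : ∀ {t} → Labeling t → Letter
rootLabel (leaf a)     = a
rootLabel (node a _ _) = a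

leafWord : ∀ {t} → Labeling t → Word
leafWord (leaf a)     = [ a ]
leafWord (node _ f g) = leafWord f ++ leafWord g

ObeysRules : ∀ {t} → Labeling t → Set
ObeysRules (leaf _)     = ⊤
ObeysRules (node a f g) =
  Rule a (rootLabel f) (rootLabel g) × ObeysRules f × ObeysRules g

-- The requirement that w has as many letters as t has leaves is implied:
-- see length-leafWord.
Parses : BinaryTree → Word → Set
Parses t w = Σ[ f ∈ Labeling t ] (leafWord f ≡ w × ObeysRules f)

length-leafWord : ∀ {t} (f : Labeling t) → length (leafWord f) ≡ leafCount t
length-leafWord (leaf _)     = refl
length-leafWord (node _ f g) = trans (length-++ (leafWord f))
  (cong₂ _+_ (length-leafWord f) (length-leafWord g))

infix 4 _∼_

_∼_ : Word → Word → Set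
v ∼ w = Σ[ σ ∈ Permutation′ 3 ] map (σ ⟨$⟩ʳ_) v ≡ w

∼-refl : ∀ {w} → w ∼ w
∼-refl {w} = Perm.id , map-id w

∼-sym : ∀ {v w} → v ∼ w → w ∼ v
∼-sym {v} (σ , refl) = flip σ ,
  trans (sym (map-∘ v)) (trans (map-cong (λ _ → Perm.inverseˡ σ) v) (map-id v))

∼-trans : ∀ {u v w} → u ∼ v → v ∼ w → u ∼ w
∼-trans {u} (σ , refl) (τ , refl) = σ ∘ₚ τ , map-∘ u

∼-setoid : Setoid 0ℓ 0ℓ
∼-setoid = record
  { Carrier       = Word
  ; _≈_           = _∼_
  ; isEquivalence = record { refl = ∼-refl ; sym = ∼-sym ; trans = ∼-trans }
  }

-- The set of equivalence classes, presented as a setoid. Its equality compares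
-- only the words, not the labelings witnessing that they are parsed.
ParseWords : BinaryTree → BinaryTree → Setoid 0ℓ 0ℓ
ParseWords t₁ t₂ =
  On.setoid {B = ∃[ w ] (Parses t₁ w × Parses t₂ w)} ∼-setoid proj₁

infix 4 ∣_∣≡_

∣_∣≡_ : Setoid 0ℓ 0ℓ → ℕ → Set
∣ S ∣≡ k = Bijection (setoid (Fin k)) S

data Side : Set where
  l r : Side

opposite : Side → Side
opposite l = r
opposite r = l

-- The letters are read from the root down: the first one says which child of
-- the root has children itself. The empty word gives the tree with two leaves.
pathTree : List Side → BinaryTree
pathTree []       = node leaf leaf
pathTree (l ∷ xs) = node (pathTree xs) leaf
pathTree (r ∷ xs) = node leaf (pathTree xs)

alternating : Side → ℕ → List Side
alternating x zero    = []
alternating x (suc k) = x ∷ alternating (opposite x) k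

-- Meaningful for n ≥ 2 only.
LeftCrookedTree RightCrookedTree : ℕ → BinaryTree
LeftCrookedTree  n = pathTree (alternating l (n ∸ 2))
RightCrookedTree n = pathTree (alternating r (n ∸ 2))

leafCount-pathTree : ∀ xs → leafCount (pathTree xs) ≡ 2 + length xs
leafCount-pathTree []       = refl
leafCount-pathTree (l ∷ xs) =
  trans (+-comm (leafCount (pathTree xs)) 1) (cong suc (leafCount-pathTree xs))
leafCount-pathTree (r ∷ xs) = cong suc (leafCount-pathTree xs)

length-alternating : ∀ x k → length (alternating x k) ≡ k
length-alternating x zero    = refl
length-alternating x (suc k) = cong suc (length-alternating (opposite x) k)

leafCount-LeftCrookedTree : ∀ {n} → 2 ≤ n → leafCount (LeftCrookedTree n) ≡ n
leafCount-LeftCrookedTree {suc (suc k)} (s≤s (s≤s _)) =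
  trans (leafCount-pathTree (alternating l k)) (cong (2 +_) (length-alternating l k))

leafCount-RightCrookedTree : ∀ {n} → 2 ≤ n → leafCount (RightCrookedTree n) ≡ n
leafCount-RightCrookedTree {suc (suc k)} (s≤s (s≤s _)) =
  trans (leafCount-pathTree (alternating r k)) (cong (2 +_) (length-alternating r k))

{-# OPTIONS --safe #-}
-- Read bottom-up, the two crooked trees with n + 2 leaves are ((∙ L) ∙) and
-- (∙ (R ∙)) with L and R the crooked trees with n leaves. If L and R give a word
-- w the same root label s, then x w y is parsed by both larger trees exactly
-- when x ≢ s and y ≡ x, and its root label is again s. So each step outwards is
-- a free choice between two letters, starting from the word ab, or from the
-- letter b, around which the first choice is a ≢ b. A permutation of the
-- alphabet normalises a and b to 0 and 1, and no freedom is left after that.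
module Submission where

open import Defs
open import Data.Empty using (⊥-elim)
open import Data.Fin using (Fin; punchIn; punchOut)
open import Data.Fin.Patterns using (0F; 1F; 2F)
open import Data.Fin.Permutation as Perm
  using (Permutation′; _⟨$⟩ʳ_; _⟨$⟩ˡ_; _∘ₚ_; transpose)
open import Data.Fin.Properties
  using (*↔×; all?; _≟_; punchIn-injective; punchInᵢ≢i; punchIn-punchOut)
open import Data.List using ([]; _∷_; [_]; _∷ʳ_; map)
open import Data.List.Properties using (∷-injective; ∷ʳ-injective; map-++)
open import Data.Nat using (ℕ; suc; _+_; _*_; _≤_; _^_; _∸_; ⌊_/2⌋; s≤s)
open import Data.Product using (∃-syntax; Σ-syntax; _×_; _,_; proj₁; proj₂)
open import Data.Unit using (tt)
open import Function.Bundles using (_↔_; Inverse; Injection)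
open import Function.Properties.Inverse using (↔⇒↣)
open import Relation.Binary.PropositionalEquality
  using (_≡_; _≢_; refl; sym; trans; cong; cong₂; subst; module ≡-Reasoning)
open import Relation.Nullary.Decidable using (from-yes; ¬?; _→-dec_)

open ≡-Reasoning

rule-distinct : ∀ {a b c} → Rule a b c → b ≢ c
rule-distinct () refl

rule-flip : ∀ {a b c} → Rule a b c → Rule a c b
rule-flip 0→12 = 0→21
rule-flip 0→21 = 0→12
rule-flip 1→02 = 1→20
rule-flip 1→20 = 1→02
rule-flip 2→01 = 2→10
rule-flip 2→10 = 2→01

-- A rule says only that its three letters are pairwise distinct. Together with `rule-flip` this
-- yields every rearrangement of them, so any two labels at a vertex determine the third.
rule-rotate : ∀ {a b c} → Rule a b c → Rule c a b
rule-rotate 0→12 = 2→01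
rule-rotate 0→21 = 1→02
rule-rotate 1→02 = 2→10
rule-rotate 1→20 = 0→12
rule-rotate 2→01 = 1→20
rule-rotate 2→10 = 0→21

rule-exists : ∀ {a b} → a ≢ b → ∃[ c ] Rule c a b
rule-exists {0F} {0F} a≢b = ⊥-elim (a≢b refl)
rule-exists {0F} {1F} _   = 2F , 2→01
rule-exists {0F} {2F} _   = 1F , 1→02
rule-exists {1F} {0F} _   = 2F , 2→10
rule-exists {1F} {1F} a≢b = ⊥-elim (a≢b refl)
rule-exists {1F} {2F} _   = 0F , 0→12
rule-exists {2F} {0F} _   = 1F , 1→20
rule-exists {2F} {1F} _   = 0F , 0→21
rule-exists {2F} {2F} a≢b = ⊥-elim (a≢b refl)

rule-functional : ∀ {a b c d} → Rule c a b → Rule d a b → c ≡ d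
rule-functional 0→12 0→12 = refl
rule-functional 0→21 0→21 = refl
rule-functional 1→02 1→02 = refl
rule-functional 1→20 1→20 = refl
rule-functional 2→01 2→01 = refl
rule-functional 2→10 2→10 = refl

rule-irreflexive : ∀ {a b c} → Rule a b c → a ≢ b
rule-irreflexive R = rule-distinct (rule-rotate R)

-- Settled by deciding all 81 quadruples of letters.
fourth-letter : ∀ (a b c d : Letter) → a ≢ b → a ≢ c → b ≢ c → d ≢ b → d ≢ c → d ≡ a
fourth-letter = from-yes (all? {n = 3} λ a → all? λ b → all? λ c → all? λ d →
  ¬? (a ≟ b) →-dec ¬? (a ≟ c) →-dec ¬? (b ≟ c) →-dec
  ¬? (d ≟ b) →-dec ¬? (d ≟ c) →-dec (d ≟ a))

permutation-of-rule : ∀ {a b c} → Rule c a b →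
  Σ[ σ ∈ Permutation′ 3 ] (σ ⟨$⟩ʳ 0F ≡ a × σ ⟨$⟩ʳ 1F ≡ b × σ ⟨$⟩ʳ 2F ≡ c)
permutation-of-rule 2→01 = Perm.id , refl , refl , refl
permutation-of-rule 2→10 = transpose 0F 1F , refl , refl , refl
permutation-of-rule 1→02 = transpose 1F 2F , refl , refl , refl
permutation-of-rule 0→21 = transpose 0F 2F , refl , refl , refl
-- The last two cases are the 3-cycles; `∘ₚ` applies its left factor first.
permutation-of-rule 0→12 = transpose 0F 1F ∘ₚ transpose 0F 2F , refl , refl , refl
permutation-of-rule 1→20 = transpose 0F 1F ∘ₚ transpose 1F 2F , refl , refl , refl

permutation-injective : ∀ {n} (σ : Permutation′ n) {i j} → σ ⟨$⟩ʳ i ≡ σ ⟨$⟩ʳ j → i ≡ j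
permutation-injective σ = Injection.injective (↔⇒↣ σ)

fixes-all : (σ : Permutation′ 3) → σ ⟨$⟩ʳ 0F ≡ 0F → σ ⟨$⟩ʳ 1F ≡ 1F → ∀ a → σ ⟨$⟩ʳ a ≡ a
fixes-all σ σ0 σ1 0F = σ0
fixes-all σ σ0 σ1 1F = σ1
fixes-all σ σ0 σ1 2F = fourth-letter 2F 0F 1F _ (λ ()) (λ ()) (λ ())
  (λ σ2≡0 → 2≢0 (permutation-injective σ (trans σ2≡0 (sym σ0))))
  (λ σ2≡1 → 2≢1 (permutation-injective σ (trans σ2≡1 (sym σ1))))
  where
  2≢0 : 2F ≢ 0F
  2≢0 ()
  2≢1 : 2F ≢ 1F
  2≢1 ()

wrap : Letter → Word → Word
wrap x w = x ∷ w ∷ʳ x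

wrap-injective : ∀ {x y} v w → wrap x v ≡ wrap y w → x ≡ y × v ≡ w
wrap-injective v w eq =
  let x≡y , eq′ = ∷-injective eq in x≡y , proj₁ (∷ʳ-injective v w eq′)

map-wrap : ∀ (f : Letter → Letter) x w → map f (wrap x w) ≡ wrap (f x) (map f w)
map-wrap f x w = cong (f x ∷_) (map-++ f w [ x ])

-- Keeps the root label visible: it is all that the outer layers see of an inner parse.
Derives : BinaryTree → Letter → Word → Set
Derives t a w = Σ[ f ∈ Labeling t ] (leafWord f ≡ w × ObeysRules f × rootLabel f ≡ a)

derives⇒parses : ∀ {t a w} → Derives t a w → Parses t w
derives⇒parses (f , eq , obeys , _) = f , eq , obeys

parses⇒derives : ∀ {t w} → Parses t w → ∃[ a ] Derives t a w
parses⇒derives (f , eq , obeys) = rootLabel f , f , eq , obeys , refl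

RootsAgree : BinaryTree → BinaryTree → Set
RootsAgree t u = ∀ {a b w} → Derives t a w → Derives u b w → a ≡ b

wrapˡ wrapʳ : BinaryTree → BinaryTree
wrapˡ t = node (node leaf t) leaf
wrapʳ t = node leaf (node t leaf)

-- The inner new vertex must get the third letter `c`; the root, above `c` and `x`, then gets `a`
-- again.
derives-wrapˡ : ∀ {t a w x} → x ≢ a → Derives t a w → Derives (wrapˡ t) a (wrap x w)
derives-wrapˡ {x = x} x≢a (f , refl , obeys , refl) =
  let c , R = rule-exists x≢a in
  node _ (node c (leaf x) f) (leaf x) , refl , (rule-rotate R , (R , tt , obeys) , tt) , refl

derives-wrapʳ : ∀ {t a w x} → x ≢ a → Derives t a w → Derives (wrapʳ t) a (wrap x w)
derives-wrapʳ {x = x} x≢a (f , refl , obeys , refl) =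
  let c , R = rule-exists x≢a in
  node _ (leaf x) (node c f (leaf x)) , refl ,
  (rule-flip (rule-rotate R) , tt , rule-flip R , obeys , tt) , refl

unwrap : ∀ {t u a b w} → RootsAgree t u → Derives (wrapˡ t) a w → Derives (wrapʳ u) b w →
  a ≡ b × ∃[ x ] ∃[ v ] (wrap x v ≡ w × x ≢ a × Derives t a v × Derives u a v)
unwrap agree
  (node a (node c (leaf x) f) (leaf y) , refl , (acy , (cxs , _ , obeysf) , _) , refl)
  (node b (leaf _) (node d g (leaf _)) , eq , (bxd , _ , dsy , obeysg , _) , refl)
  with refl , eq′ ← ∷-injective eq
  with g≡f , refl ← ∷ʳ-injective (leafWord g) (leafWord f) eq′
  with s≡s′ ← agree (f , refl , obeysf , refl) (g , g≡f , obeysg , refl)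
  -- From here on both inner trees have the root label `rootLabel f`, called s below.
  with dsy ← subst (λ s → Rule d s y) (sym s≡s′) dsy
  -- The right tree excludes y = s and the left tree excludes y = c, which leaves only y = x.
  with refl ← fourth-letter x (rootLabel f) c y
    (rule-distinct cxs) (λ x≡c → rule-irreflexive cxs (sym x≡c))
    (λ s≡c → rule-irreflexive (rule-flip cxs) (sym s≡c))
    (λ y≡s → rule-distinct dsy (sym y≡s)) (λ y≡c → rule-distinct acy (sym y≡c))
  -- Both a and s are the third letter beside c and x, so a = s. In the right tree b and s are
  -- likewise the third letter beside x and d.
  with refl ← rule-functional acy (rule-rotate cxs)
  = rule-functional (rule-rotate (rule-rotate dsy)) bxd
  , x , leafWord f , refl , rule-distinct cxs
  , (f , refl , obeysf , refl) , (g , g≡f , obeysg , sym s≡s′)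

leftCrooked rightCrooked : ℕ → BinaryTree
leftCrooked  k = LeftCrookedTree (2 + k)
rightCrooked k = RightCrookedTree (2 + k)

leaf-rootsAgree : RootsAgree leaf leaf
leaf-rootsAgree (leaf a , refl , _ , refl) (leaf .a , refl , _ , refl) = refl

-- Induction in steps of two: the crooked trees for `2 + k` unfold to `wrapˡ` and `wrapʳ` of those
-- for `k`, and `unwrap` passes agreement outwards. For `k = 1` the core is a single leaf.
crooked-rootsAgree : ∀ k → RootsAgree (leftCrooked k) (rightCrooked k)
crooked-rootsAgree 0 (node _ (leaf _) (leaf _) , refl , (R , _) , refl)
                     (node _ (leaf _) (leaf _) , refl , (S , _) , refl) = rule-functional R S
crooked-rootsAgree 1 d e = proj₁ (unwrap leaf-rootsAgree d e)
crooked-rootsAgree (suc (suc k)) d e = proj₁ (unwrap (crooked-rootsAgree k) d e)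

repRoot : ℕ → Letter
repRoot 0             = 2F
repRoot 1             = 1F
repRoot (suc (suc k)) = repRoot k

-- Applies to the indices of `rep` because `2 ^ ⌊ 2 + k /2⌋` computes to `2 * 2 ^ ⌊ k /2⌋`: one
-- binary choice per layer.
splitIndex : ∀ {m} → Fin (2 * m) ↔ (Fin 2 × Fin m)
splitIndex = *↔×

-- `punchIn a` enumerates the two letters other than `a`.
wrapChoice : ∀ {m} → Letter → (Fin m → Word) → Fin 2 × Fin m → Word
wrapChoice a f (b , i) = wrap (punchIn a b) (f i)

rep : ∀ k → Fin (2 ^ ⌊ k /2⌋) → Word
rep 0             _ = 0F ∷ 1F ∷ []
rep 1             _ = wrap 0F [ 1F ]
rep (suc (suc k)) i = wrapChoice (repRoot k) (rep k) (Inverse.to splitIndex i)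

rep-derived : ∀ k i → Derives (leftCrooked k) (repRoot k) (rep k i) ×
                      Derives (rightCrooked k) (repRoot k) (rep k i)
rep-derived 0 _ = d , d
  where
  d : Derives (node leaf leaf) 2F (0F ∷ 1F ∷ [])
  d = node 2F (leaf 0F) (leaf 1F) , refl , (2→01 , tt , tt) , refl
rep-derived 1 _ = derives-wrapˡ (λ ()) d , derives-wrapʳ (λ ()) d
  where
  d : Derives leaf 1F [ 1F ]
  d = leaf 1F , refl , tt , refl
rep-derived (suc (suc k)) i =
  let b , j = Inverse.to splitIndex i
      d , e = rep-derived k j
      x≢a   = punchInᵢ≢i (repRoot k) b
  in derives-wrapˡ x≢a d , derives-wrapʳ x≢a e

-- The innermost letters force σ to fix 0 and 1, hence everything; the choices can then be compared
-- layer by layer. This makes distinct indices inequivalent.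
map-rep-rigid : ∀ k {i j} (σ : Permutation′ 3) → map (σ ⟨$⟩ʳ_) (rep k i) ≡ rep k j →
  (∀ a → σ ⟨$⟩ʳ a ≡ a) × i ≡ j
map-rep-rigid 0 {0F} {0F} σ eq =
  let σ0 , eq′ = ∷-injective eq
      σ1 , _   = ∷-injective eq′
  in fixes-all σ σ0 σ1 , refl
map-rep-rigid 1 {0F} {0F} σ eq =
  let σ0 , eq′ = ∷-injective eq
      σ1 , _   = ∷-injective eq′
  in fixes-all σ σ0 σ1 , refl
map-rep-rigid (suc (suc k)) {i} {j} σ eq =
  let b , i′    = Inverse.to splitIndex i
      c , j′    = Inverse.to splitIndex j
      a         = repRoot k
      x≡y , eq′ = wrap-injective (map (σ ⟨$⟩ʳ_) (rep k i′)) (rep k j′)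
                    (trans (sym (map-wrap (σ ⟨$⟩ʳ_) (punchIn a b) (rep k i′))) eq)
      fix , i≡j = map-rep-rigid k σ eq′
      b≡c       = punchIn-injective a b c (trans (sym (fix _)) x≡y)
  in fix , Injection.injective (↔⇒↣ splitIndex) (cong₂ _,_ b≡c i≡j)

-- The condition on the root turns the constraint on the next letter, x ≢ a, into one on its
-- preimage under σ.
Represented : ℕ → Letter → Word → Set
Represented k a w = Σ[ σ ∈ Permutation′ 3 ] Σ[ i ∈ Fin (2 ^ ⌊ k /2⌋) ]
  (map (σ ⟨$⟩ʳ_) (rep k i) ≡ w × σ ⟨$⟩ʳ repRoot k ≡ a)

represented-wrap : ∀ k {a w x} → x ≢ a → Represented k a w → Represented (2 + k) a (wrap x w)
represented-wrap k {x = x} x≢σa (σ , i , refl , refl) =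
  σ , Inverse.from splitIndex (b , i) , eq , refl
  where
  a≢σ⁻¹x : repRoot k ≢ σ ⟨$⟩ˡ x
  a≢σ⁻¹x a≡σ⁻¹x = x≢σa (sym (trans (cong (σ ⟨$⟩ʳ_) a≡σ⁻¹x) (Perm.inverseʳ σ)))
  b : Fin 2
  -- The choice is read off from the preimage of `x`, so the same σ serves the larger word.
  b = punchOut a≢σ⁻¹x
  eq : map (σ ⟨$⟩ʳ_) (rep (2 + k) (Inverse.from splitIndex (b , i)))
       ≡ wrap x (map (σ ⟨$⟩ʳ_) (rep k i))
  eq = begin
    map (σ ⟨$⟩ʳ_) (rep (2 + k) (Inverse.from splitIndex (b , i)))
      ≡⟨ cong (λ bi → map (σ ⟨$⟩ʳ_) (wrapChoice (repRoot k) (rep k) bi))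
              (Inverse.strictlyInverseˡ splitIndex (b , i)) ⟩
    map (σ ⟨$⟩ʳ_) (wrap (punchIn (repRoot k) b) (rep k i))
      ≡⟨ map-wrap (σ ⟨$⟩ʳ_) _ (rep k i) ⟩
    wrap (σ ⟨$⟩ʳ punchIn (repRoot k) b) (map (σ ⟨$⟩ʳ_) (rep k i))
      ≡⟨ cong (λ y → wrap y (map (σ ⟨$⟩ʳ_) (rep k i)))
              (trans (cong (σ ⟨$⟩ʳ_) (punchIn-punchOut a≢σ⁻¹x)) (Perm.inverseʳ σ)) ⟩
    wrap x (map (σ ⟨$⟩ʳ_) (rep k i)) ∎

derived⇒represented : ∀ k {a w} → Derives (leftCrooked k) a w → Derives (rightCrooked k) a w →
  Represented k a w
derived⇒represented 0 (node _ (leaf _) (leaf _) , refl , (R , _) , refl) _ =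
  let σ , σ0 , σ1 , σ2 = permutation-of-rule R
  in σ , 0F , cong₂ (λ x y → x ∷ y ∷ []) σ0 σ1 , σ2
derived⇒represented 1 d e with unwrap leaf-rootsAgree d e
... | _ , x , _ , refl , x≢a , (leaf a , refl , _ , refl) , _ =
  -- The word is x a x: σ sends 0 to x and the core letter 1, also the root label, to a.
  let _ , R            = rule-exists x≢a
      σ , σ0 , σ1 , _  = permutation-of-rule R
  in σ , 0F , cong₂ (λ x y → wrap x [ y ]) σ0 σ1 , σ1
derived⇒represented (suc (suc k)) d e with unwrap (crooked-rootsAgree k) d e
... | _ , _ , _ , refl , x≢a , d′ , e′ =
  represented-wrap k x≢a (derived⇒represented k d′ e′)

parsed⇒represented : ∀ k {w} → Parses (leftCrooked k) w → Parses (rightCrooked k) w →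
  Σ[ i ∈ Fin (2 ^ ⌊ k /2⌋) ] rep k i ∼ w
parsed⇒represented k p q =
  let _ , d           = parses⇒derives p
      _ , e           = parses⇒derives q
      a≡b             = crooked-rootsAgree k d e
      σ , i , eq , _  = derived⇒represented k d (subst (λ a → Derives _ a _) (sym a≡b) e)
  in i , σ , eq

theorem8 : (n : ℕ) → 2 ≤ n →
    ∣ ParseWords (LeftCrookedTree n) (RightCrookedTree n) ∣≡ 2 ^ (⌊ n /2⌋ ∸ 1)
-- With n = 2 + k the exponent `⌊ n /2⌋ ∸ 1` computes to `⌊ k /2⌋`, the one indexing `rep k`.
theorem8 (suc (suc k)) (s≤s (s≤s _)) = record
  { to        = λ i → let d , e = rep-derived k i
                      in rep k i , derives⇒parses d , derives⇒parses e
  ; cong      = λ { refl → ∼-refl }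
  ; bijective = (λ (σ , eq) → proj₂ (map-rep-rigid k σ eq))
              , λ (_ , p , q) → let i , i∼w = parsed⇒represented k p q
                                in i , λ { refl → i∼w }
  }
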